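{- For any wheel $W_n$ of order $n\geq 4$, $\gamma_{\times 2R}(W_n)=\left\lceil\frac{2(n-1)}{3}\right\rceil+2$.
   Context: For a finite simple graph $G=(V,E)$ with minimum degree at least $1$, a Roman $2$-tuple dominating function on $G$ is a function $f\colon V\to\{0,1,2\}$ such that every vertex $v$ with $f(v)=0$ has at least $2$ neighbors $w$ with $f(w)=2$, and every vertex $v$ with $f(v)\neq 0$ has at least $1$ neighbor $w$ with $f(w)=2$. The weight of $f$ is $f(V)=\sum_{v\in V}f(v)$, and $\gamma_{\times 2R}(G)$ is the minimum weight of a Roman $2$-tuple dominating function on $G$. The wheel $W_n$ of order $n\geq 4$ has vertex set $\{v_0,v_1,\dots,v_{n-1}\}$, where $v_1,\dots,v_{n-1}$ form a cycle of length $n-1$ in this cyclic order and $v_0$ is adjacent to all of $v_1,\dots,v_{n-1}$. -}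

module Defs where

open import Algebra.Properties.CommutativeMonoid.Sum using (sum)
open import Data.Empty using (⊥)
open import Data.Fin using (Fin; zero; suc; toℕ)
open import Data.Fin.Patterns using (0F; 2F)
import Data.Fin.Properties as Fin
open import Data.List using (List; filter; length; allFin)
open import Data.Nat using (ℕ; zero; suc; _+_; _*_; _∸_; _/_; _≤_; _≟_; s≤s; NonZero)
open import Data.Nat.Properties using (+-0-commutativeMonoid; ≤-antisym; 1+n≢n)
open import Data.Product using (∃; _×_; _,_)
open import Data.Sum using (_⊎_; inj₁; inj₂; swap)
open import Data.Unit using (⊤; tt)
open import Level using (0ℓ)
open import Relation.Binary using (Rel; Decidable; Symmetric; Irreflexive)
open import Relation.Binary.PropositionalEquality using (_≡_; _≢_; refl; sym; trans; cong)
open import Relation.Nullary using (yes; no)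
open import Relation.Nullary.Decidable using (_×-dec_; _⊎-dec_)

record SimpleGraph (n : ℕ) : Set₁ where
  field
    Adj    : Rel (Fin n) 0ℓ
    adj?   : Decidable Adj
    symm   : Symmetric Adj
    irrefl : Irreflexive _≡_ Adj

open SimpleGraph public

Labelling : ℕ → Set
Labelling n = Fin n → Fin 3

weight : ∀ {n} → Labelling n → ℕ
weight f = sum +-0-commutativeMonoid (λ v → toℕ (f v))

neighboursLabelled2 : ∀ {n} → SimpleGraph n → Labelling n → Fin n → List (Fin n)
neighboursLabelled2 {n} G f v = filter (λ w → adj? G v w ×-dec (f w Fin.≟ 2F)) (allFin n)

record IsRoman2TupleDominating {n} (G : SimpleGraph n) (f : Labelling n) : Set where
  field
    at-zero    : ∀ v → f v ≡ 0F → 2 ≤ length (neighboursLabelled2 G f v)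
    at-nonzero : ∀ v → f v ≢ 0F → 1 ≤ length (neighboursLabelled2 G f v)

-- The minimum is a relation between a graph and a number.  No minimum-degree
-- hypothesis is imposed: a dominating function gives every vertex a neighbour,
-- so for a graph with an isolated vertex the relation holds of no number.
record γ×2R[_]=_ {n} (G : SimpleGraph n) (k : ℕ) : Set where
  field
    attained : ∃ λ f → IsRoman2TupleDominating G f × weight f ≡ k
    minimal  : ∀ f → IsRoman2TupleDominating G f → k ≤ weight f

γ×2R-unique : ∀ {n} {G : SimpleGraph n} {k l} → γ×2R[ G ]= k → γ×2R[ G ]= l → k ≡ l
γ×2R-unique
  record { attained = f , f-dom , refl ; minimal = f-min }
  record { attained = g , g-dom , refl ; minimal = g-min }
  = ≤-antisym (f-min g g-dom) (g-min f f-dom)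

CyclicSucc : ∀ m → Rel (Fin m) 0ℓ
CyclicSucc m i j = suc (toℕ i) ≡ toℕ j ⊎ (suc (toℕ i) ≡ m × toℕ j ≡ 0)

cyclicSucc? : ∀ m → Decidable (CyclicSucc m)
cyclicSucc? m i j = (suc (toℕ i) ≟ toℕ j) ⊎-dec ((suc (toℕ i) ≟ m) ×-dec (toℕ j ≟ 0))

cyclicSucc-irrefl : ∀ {m} → 3 ≤ m → Irreflexive _≡_ (CyclicSucc m)
cyclicSucc-irrefl _ refl (inj₁ eq) = 1+n≢n eq
cyclicSucc-irrefl 3≤m refl (inj₂ (last , first)) with trans (sym last) (cong suc first)
cyclicSucc-irrefl (s≤s ()) refl (inj₂ _) | refl

cycle : ∀ m → 3 ≤ m → SimpleGraph m
cycle m 3≤m = record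
  { Adj    = λ i j → CyclicSucc m i j ⊎ CyclicSucc m j i
  ; adj?   = λ i j → cyclicSucc? m i j ⊎-dec cyclicSucc? m j i
  ; symm   = swap
  ; irrefl = λ { refl (inj₁ s) → cyclicSucc-irrefl 3≤m refl s
               ; refl (inj₂ s) → cyclicSucc-irrefl 3≤m refl s }
  }

-- Adds a new vertex, zero, adjacent to every vertex of G.
cone : ∀ {m} → SimpleGraph m → SimpleGraph (suc m)
cone {m} G = record { Adj = A ; adj? = A? ; symm = λ {i} {j} → A-sym i j ; irrefl = λ { {i} refl → A-irrefl i } }
  where
  A : Rel (Fin (suc m)) 0ℓ
  A zero    zero    = ⊥
  A zero    (suc _) = ⊤
  A (suc _) zero    = ⊤
  A (suc i) (suc j) = Adj G i j

  A? : Decidable A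
  A? zero    zero    = no λ ()
  A? zero    (suc _) = yes tt
  A? (suc _) zero    = yes tt
  A? (suc i) (suc j) = adj? G i j

  A-sym : ∀ i j → A i j → A j i
  A-sym zero    (suc _) _ = tt
  A-sym (suc _) zero    _ = tt
  A-sym (suc i) (suc j) a = symm G a

  A-irrefl : ∀ i → A i i → ⊥
  A-irrefl (suc i) a = irrefl G refl a

-- n is the order: the hub v₀ is zero, and the rim vertex vᵢ₊₁ is suc i.
wheel : ∀ n → 4 ≤ n → SimpleGraph n
wheel (suc m) (s≤s 3≤m) = cone (cycle m 3≤m)

⌈_/_⌉ : (m d : ℕ) .{{_ : NonZero d}} → ℕ
⌈ m / d ⌉ = (m + (d ∸ 1)) / d

{-# OPTIONS --safe #-}

-- Lower bound: domination says exactly that every vertex v satisfies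
-- 2 ≤ #(neighbours of v labelled 2) + [f v ≠ 0].  Sum this over the m = n ∸ 1
-- rim vertices.  A rim vertex labelled 2 is counted by its two rim neighbours
-- and once by itself, so it contributes 3 = (3 / 2) · 2; a vertex labelled 1
-- contributes 1 ≤ (3 / 2) · 1; the hub contributes m when it is labelled 2.
-- Hence 4 m ≤ 2 m [f v₀ = 2] + 3 (weight of the rim).  If the hub has label 2
-- this leaves 2 m for the rim; otherwise 4 m ≥ 2 m + 6 because m ≥ 3.
--
-- Upper bound: label the hub 2 and the rim by the repeating pattern 0 2 0,
-- cut short to 1 or to 0 2 at the end.
module Submission where

open import Defs
import Algebra.Properties.Semiring.Sum
open import Data.Bool using (true; false; if_then_else_)
open import Data.Fin using (Fin; zero; suc; toℕ)
open import Data.Fin.Patterns using (0F; 1F; 2F)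
import Data.Fin.Properties as Fin
open import Data.List using (filter; length; tabulate)
open import Data.List.Properties using (filter-some)
open import Data.List.Relation.Unary.Any.Properties using (tabulate⁺)
open import Data.Nat using (ℕ; zero; suc; _+_; _*_; _∸_; _/_; _≤_; z≤n; s≤s; NonZero)
open import Data.Nat.DivMod using (m/n*n≤m; +-distrib-/-∣ʳ)
open import Data.Nat.Divisibility using (divides-refl)
open import Data.Nat.Properties
open import Data.Nat.Tactic.RingSolver using (solve-∀)
open import Data.Product using (∃; _×_; _,_)
open import Data.Sum using (_⊎_; inj₁; inj₂; map)
open import Function using (_∘_)
open import Relation.Binary.PropositionalEquality
  using (_≡_; _≢_; refl; sym; trans; cong; cong₂; module ≡-Reasoning)
open import Relation.Nullary using (Dec; yes; no; does; ¬?; contradiction)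
open import Relation.Nullary.Decidable using (_×-dec_; _⊎-dec_; dec-false)
open import Relation.Unary using (Pred; Decidable)

open Algebra.Properties.Semiring.Sum +-*-semiring
  using (sum; sum-syntax; ∑-comm; ∑-distrib-+; sum-cong-≗; *-distribˡ-sum; *-distribʳ-sum)

-- Finite sums and indicators.

∑-mono-≤ : ∀ {n} {f g : Fin n → ℕ} → (∀ i → f i ≤ g i) → sum f ≤ sum g
∑-mono-≤ {zero}  f≤g = z≤n
∑-mono-≤ {suc n} f≤g = +-mono-≤ (f≤g zero) (∑-mono-≤ (f≤g ∘ suc))

∑-const : ∀ n c → ∑[ i < n ] c ≡ n * c
∑-const zero    c = refl
∑-const (suc n) c = cong (c +_) (∑-const n c)

⟦_⟧ : ∀ {p} {P : Set p} → Dec P → ℕ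
⟦ P? ⟧ = if does P? then 1 else 0

⟦×⟧ : ∀ {p q} {P : Set p} {Q : Set q} (P? : Dec P) (Q? : Dec Q) →
      ⟦ P? ×-dec Q? ⟧ ≡ ⟦ P? ⟧ * ⟦ Q? ⟧
⟦×⟧ P? Q? with does P?
... | true  = sym (+-identityʳ ⟦ Q? ⟧)
... | false = refl

⟦⊎⟧≤ : ∀ {p q} {P : Set p} {Q : Set q} (P? : Dec P) (Q? : Dec Q) →
       ⟦ P? ⊎-dec Q? ⟧ ≤ ⟦ P? ⟧ + ⟦ Q? ⟧
⟦⊎⟧≤ P? Q? with does P?
... | true  = s≤s z≤n
... | false = ≤-refl

-- Turns neighbour counts into sums of indicators, so that the order of summation can be exchanged.
length-filter-tabulate : ∀ {a p} {A : Set a} {P : Pred A p} (P? : Decidable P) {n} (g : Fin n → A) →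
                         length (filter P? (tabulate g)) ≡ ∑[ i < n ] ⟦ P? (g i) ⟧
length-filter-tabulate P? {zero}  g = refl
length-filter-tabulate P? {suc n} g with does (P? (g zero))
... | true  = cong suc (length-filter-tabulate P? (g ∘ suc))
... | false = length-filter-tabulate P? (g ∘ suc)

∑-unique≤1 : ∀ {n p} {P : Pred (Fin n) p} (P? : Decidable P) →
             (∀ {i j} → P i → P j → i ≡ j) → ∑[ i < n ] ⟦ P? i ⟧ ≤ 1
∑-unique≤1 {zero}  P? unique = z≤n
∑-unique≤1 {suc n} P? unique with P? zero
... | no  _  = ∑-unique≤1 (P? ∘ suc) (λ p q → Fin.suc-injective (unique p q))
-- A hit at `zero` makes every later indicator vanish.
... | yes p₀ = s≤s (≤-reflexive (trans (sum-cong-≗ vanishes) (trans (∑-const n 0) (*-zeroʳ n))))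
  where
  vanishes : ∀ i → ⟦ P? (suc i) ⟧ ≡ 0
  vanishes i = cong (if_then 1 else 0) (dec-false (P? (suc i)) λ p → contradiction (unique p₀ p) λ ())

-- Degrees in the cycle.

CyclicSucc-functional : ∀ {m} {i j k : Fin m} → CyclicSucc m i j → CyclicSucc m i k → j ≡ k
CyclicSucc-functional (inj₁ p) (inj₁ q) = Fin.toℕ-injective (trans (sym p) q)
-- In the mixed cases the value of an element of `Fin m` would be `m` itself.
CyclicSucc-functional {j = j} (inj₁ p) (inj₂ (q , _)) = contradiction (trans (sym p) q) (<⇒≢ (Fin.toℕ<n j))
CyclicSucc-functional {k = k} (inj₂ (p , _)) (inj₁ q) = contradiction (trans (sym q) p) (<⇒≢ (Fin.toℕ<n k))
CyclicSucc-functional (inj₂ (_ , p)) (inj₂ (_ , q)) = Fin.toℕ-injective (trans p (sym q))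

CyclicSucc-injective : ∀ {m} {i j k : Fin m} → CyclicSucc m i k → CyclicSucc m j k → i ≡ j
CyclicSucc-injective (inj₁ p) (inj₁ q) = Fin.toℕ-injective (suc-injective (trans p (sym q)))
CyclicSucc-injective (inj₁ p) (inj₂ (_ , q)) = contradiction (trans p q) λ ()
CyclicSucc-injective (inj₂ (_ , p)) (inj₁ q) = contradiction (trans q p) λ ()
CyclicSucc-injective (inj₂ (p , _)) (inj₂ (q , _)) = Fin.toℕ-injective (suc-injective (trans p (sym q)))

-- A neighbour of `w` is a predecessor or a successor of it, and there is at most one of each.
cycle-degree≤2 : ∀ m (3≤m : 3 ≤ m) w → ∑[ v < m ] ⟦ adj? (cycle m 3≤m) v w ⟧ ≤ 2
cycle-degree≤2 m 3≤m w = begin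
  ∑[ v < m ] ⟦ cyclicSucc? m v w ⊎-dec cyclicSucc? m w v ⟧
    ≤⟨ ∑-mono-≤ (λ v → ⟦⊎⟧≤ (cyclicSucc? m v w) (cyclicSucc? m w v)) ⟩
  ∑[ v < m ] (⟦ cyclicSucc? m v w ⟧ + ⟦ cyclicSucc? m w v ⟧)
    ≡⟨ ∑-distrib-+ (λ v → ⟦ cyclicSucc? m v w ⟧) (λ v → ⟦ cyclicSucc? m w v ⟧) ⟩
  ∑[ v < m ] ⟦ cyclicSucc? m v w ⟧ + ∑[ v < m ] ⟦ cyclicSucc? m w v ⟧
    ≤⟨ +-mono-≤ (∑-unique≤1 (λ v → cyclicSucc? m v w) CyclicSucc-injective)
                (∑-unique≤1 (cyclicSucc? m w) CyclicSucc-functional) ⟩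
  2 ∎
  where open ≤-Reasoning

-- Counting labels 2 around the rim.

is2 nonzero : Fin 3 → ℕ
is2     x = ⟦ x Fin.≟ 2F ⟧
nonzero x = ⟦ ¬? (x Fin.≟ 0F) ⟧

-- The charge of 3 / 2 per unit of weight, doubled to stay in the natural numbers. It is tight for
-- labels 0 and 2.
label-charge : ∀ x → 2 * (2 * is2 x + nonzero x) ≤ 3 * toℕ x
label-charge 0F = ≤-refl
label-charge 1F = n≤1+n 2
label-charge 2F = ≤-refl

-- Merges the two domination conditions into one linear inequality that can be summed.
dominating⇒2≤ : ∀ {n} {G : SimpleGraph n} {f} → IsRoman2TupleDominating G f →
                ∀ v → 2 ≤ length (neighboursLabelled2 G f v) + nonzero (f v)
dominating⇒2≤ {G = G} {f} dom v with f v Fin.≟ 0F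
... | yes fv≡0 = m≤n⇒m≤n+o 0 (IsRoman2TupleDominating.at-zero dom v fv≡0)
... | no  fv≢0 = +-monoˡ-≤ 1 (IsRoman2TupleDominating.at-nonzero dom v fv≢0)

-- Double counting: the pairs of a vertex and a neighbour labelled 2 are grouped by that neighbour,
-- which occurs at most `d` times.
∑-neighbours≤ : ∀ {n} (G : SimpleGraph n) d → (∀ w → ∑[ v < n ] ⟦ adj? G v w ⟧ ≤ d) →
                ∀ f → ∑[ v < n ] length (neighboursLabelled2 G f v) ≤ ∑[ w < n ] (d * is2 (f w))
∑-neighbours≤ {n} G d degree≤d f = begin
  ∑[ v < n ] length (neighboursLabelled2 G f v)
    ≡⟨ sum-cong-≗ (λ v → trans (length-filter-tabulate (λ w → adj? G v w ×-dec (f w Fin.≟ 2F)) (λ w → w))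
                               (sum-cong-≗ (λ w → ⟦×⟧ (adj? G v w) (f w Fin.≟ 2F)))) ⟩
  ∑[ v < n ] ∑[ w < n ] (⟦ adj? G v w ⟧ * is2 (f w))
    ≡⟨ ∑-comm (λ v w → ⟦ adj? G v w ⟧ * is2 (f w)) ⟩
  ∑[ w < n ] ∑[ v < n ] (⟦ adj? G v w ⟧ * is2 (f w))
    ≡⟨ sum-cong-≗ (λ w → *-distribʳ-sum (is2 (f w)) (λ v → ⟦ adj? G v w ⟧)) ⟨
  ∑[ w < n ] (∑[ v < n ] ⟦ adj? G v w ⟧ * is2 (f w))
    ≤⟨ ∑-mono-≤ (λ w → *-monoˡ-≤ (is2 (f w)) (degree≤d w)) ⟩
  ∑[ w < n ] (d * is2 (f w)) ∎
  where open ≤-Reasoning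

cone-neighbours : ∀ {m} (G : SimpleGraph m) (f : Labelling (suc m)) i →
                  length (neighboursLabelled2 (cone G) f (suc i)) ≡
                  is2 (f zero) + length (neighboursLabelled2 G (f ∘ suc) i)
cone-neighbours G f i =
  trans (length-filter-tabulate (λ w → adj? (cone G) (suc i) w ×-dec (f w Fin.≟ 2F)) (λ w → w))
        (cong (is2 (f zero) +_)
              (sym (length-filter-tabulate (λ w → adj? G i w ×-dec (f (suc w) Fin.≟ 2F)) (λ w → w))))

rim-weight-bound : ∀ m (3≤m : 3 ≤ m) f → IsRoman2TupleDominating (cone (cycle m 3≤m)) f →
                   2 * (m * 2) ≤ 2 * (m * is2 (f zero)) + 3 * weight (f ∘ suc)
rim-weight-bound m 3≤m f dom = begin
  2 * (m * 2)
    ≡⟨ cong (2 *_) (∑-const m 2) ⟨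
  2 * (∑[ v < m ] 2)
    -- The neighbours of a rim vertex labelled 2 are split into the hub, counted by `h`, and those
    -- on the cycle, counted by `N v`.
    ≤⟨ *-monoʳ-≤ 2 (∑-mono-≤ (λ v → ≤-trans (dominating⇒2≤ dom (suc v))
                                            (≤-reflexive (trans (cong (_+ nonzero (g v)) (cone-neighbours C f v))
                                                                (+-assoc h (N v) (nonzero (g v))))))) ⟩
  2 * (∑[ v < m ] (h + (N v + nonzero (g v))))
    ≡⟨ cong (2 *_) (trans (∑-distrib-+ (λ _ → h) (λ v → N v + nonzero (g v)))
                          (cong₂ _+_ (∑-const m h) (∑-distrib-+ N (nonzero ∘ g)))) ⟩
  2 * (m * h + (∑[ v < m ] N v + ∑[ v < m ] nonzero (g v)))
    ≤⟨ *-monoʳ-≤ 2 (+-monoʳ-≤ (m * h) (+-monoˡ-≤ _ (∑-neighbours≤ C 2 (cycle-degree≤2 m 3≤m) g))) ⟩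
  2 * (m * h + (∑[ v < m ] (2 * is2 (g v)) + ∑[ v < m ] nonzero (g v)))
    ≡⟨ cong (λ s → 2 * (m * h + s)) (∑-distrib-+ (λ v → 2 * is2 (g v)) (nonzero ∘ g)) ⟨
  2 * (m * h + ∑[ v < m ] (2 * is2 (g v) + nonzero (g v)))
    ≡⟨ *-distribˡ-+ 2 (m * h) _ ⟩
  2 * (m * h) + 2 * ∑[ v < m ] (2 * is2 (g v) + nonzero (g v))
    ≡⟨ cong (2 * (m * h) +_) (*-distribˡ-sum 2 (λ v → 2 * is2 (g v) + nonzero (g v))) ⟩
  2 * (m * h) + ∑[ v < m ] (2 * (2 * is2 (g v) + nonzero (g v)))
    ≤⟨ +-monoʳ-≤ (2 * (m * h)) (∑-mono-≤ (label-charge ∘ g)) ⟩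
  2 * (m * h) + ∑[ v < m ] (3 * toℕ (g v))
    ≡⟨ cong (2 * (m * h) +_) (*-distribˡ-sum 3 (toℕ ∘ g)) ⟨
  2 * (m * h) + 3 * weight g ∎
  where
  open ≤-Reasoning
  C = cycle m 3≤m
  g = f ∘ suc
  h = is2 (f zero)
  N = λ v → length (neighboursLabelled2 C g v)

-- Arithmetic of the hub label and the ceiling.

hub-rim-bound : ∀ m → 3 ≤ m → ∀ x w → 2 * (m * 2) ≤ 2 * (m * is2 x) + 3 * w →
                2 * m + 2 * 3 ≤ (toℕ x + w) * 3
hub-rim-bound m 3≤m x w = case x
  where
  open ≤-Reasoning

  hub≢2 : 2 * (m * 2) ≤ 2 * (m * 0) + 3 * w → 2 * m + 2 * 3 ≤ w * 3
  hub≢2 bound = begin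
    -- Without a 2 at the hub the rim alone weighs at least 4m/3, and `3≤m` makes this at least 2m/3
    -- + 2.
    2 * m + 2 * 3          ≤⟨ +-monoʳ-≤ (2 * m) (*-monoʳ-≤ 2 3≤m) ⟩
    2 * m + 2 * m          ≡⟨ double m ⟩
    2 * (m * 2)            ≤⟨ bound ⟩
    2 * (m * 0) + 3 * w    ≡⟨ drop m w ⟩
    w * 3                  ∎
    where
    double : ∀ m → 2 * m + 2 * m ≡ 2 * (m * 2)
    double = solve-∀
    drop : ∀ m w → 2 * (m * 0) + 3 * w ≡ w * 3
    drop = solve-∀

  hub≡2 : 2 * (m * 2) ≤ 2 * (m * 1) + 3 * w → 2 * m + 2 * 3 ≤ (2 + w) * 3
  hub≡2 bound = begin
    2 * m + 2 * 3  ≤⟨ +-monoˡ-≤ 6 (+-cancelˡ-≤ (2 * (m * 1)) (2 * m) (3 * w)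
                                    (≤-trans (≤-reflexive (double m)) bound)) ⟩
    3 * w + 6      ≡⟨ shift w ⟩
    (2 + w) * 3    ∎
    where
    double : ∀ m → 2 * (m * 1) + 2 * m ≡ 2 * (m * 2)
    double = solve-∀
    shift : ∀ w → 3 * w + 6 ≡ (2 + w) * 3
    shift = solve-∀

  case : ∀ x → 2 * (m * 2) ≤ 2 * (m * is2 x) + 3 * w → 2 * m + 2 * 3 ≤ (toℕ x + w) * 3
  case 0F bound = hub≢2 bound
  -- A hub labelled 1 only adds 3 to the right-hand side.
  case 1F bound = m≤n⇒m≤o+n 3 (hub≢2 bound)
  case 2F bound = hub≡2 bound

-- The ceiling times `d` exceeds `a` by at most `d ∸ 1`, so the left side times `d` is strictly
-- below `suc k * d`; cancelling `d` gives the claim.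
⌈/⌉+-≤ : ∀ a c k d .{{_ : NonZero d}} → a + c * d ≤ k * d → ⌈ a / d ⌉ + c ≤ k
⌈/⌉+-≤ a c k (suc d-1) a+cd≤kd = ≤-pred (*-cancelʳ-< (suc d-1) _ _ (begin-strict
  (⌈ a / d ⌉ + c) * d           ≡⟨ *-distribʳ-+ d ⌈ a / d ⌉ c ⟩
  (a + d-1) / d * d + c * d     ≤⟨ +-monoˡ-≤ (c * d) (m/n*n≤m (a + d-1) d) ⟩
  a + d-1 + c * d               ≡⟨ trans (cong (_+ c * d) (+-comm a d-1)) (+-assoc d-1 a (c * d)) ⟩
  d-1 + (a + c * d)             <⟨ +-monoʳ-≤ d a+cd≤kd ⟩
  suc k * d                     ∎))
  where
  open ≤-Reasoning
  d = suc d-1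

-- A labelling that attains the bound.

rim : ∀ m → Labelling m
-- A single leftover vertex can take label 1, since being nonzero it asks for just one neighbour
-- labelled 2, namely the hub.
rim 1 0F = 1F
rim 2 0F = 0F
rim 2 1F = 2F
rim (suc (suc (suc m))) 0F = 0F
rim (suc (suc (suc m))) 1F = 2F
rim (suc (suc (suc m))) 2F = 0F
rim (suc (suc (suc m))) (suc (suc (suc i))) = rim m i

weight-rim : ∀ m → weight (rim m) ≡ ⌈ 2 * m / 3 ⌉
weight-rim 0 = refl
weight-rim 1 = refl
weight-rim 2 = refl
weight-rim (suc (suc (suc m))) = begin
  2 + weight (rim m)     ≡⟨ cong (2 +_) (weight-rim m) ⟩
  2 + (2 * m + 2) / 3    ≡⟨ +-comm 2 _ ⟩
  (2 * m + 2) / 3 + 2    ≡⟨ +-distrib-/-∣ʳ (2 * m + 2) (divides-refl 2) ⟨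
  (2 * m + 2 + 6) / 3    ≡⟨ cong (_/ 3) (shift m) ⟩
  ⌈ 2 * (3 + m) / 3 ⌉    ∎
  where
  open ≡-Reasoning
  shift : ∀ m → 2 * m + 2 + 6 ≡ 2 * (3 + m) + 2
  shift = solve-∀

-- The edge closing the cycle is never needed.
rim-dominated : ∀ m i → rim m i ≡ 0F →
                ∃ λ j → rim m j ≡ 2F × (suc (toℕ i) ≡ toℕ j ⊎ suc (toℕ j) ≡ toℕ i)
rim-dominated 2 0F _ = 1F , refl , inj₁ refl
rim-dominated 2 1F ()
rim-dominated (suc (suc (suc m))) 0F _ = 1F , refl , inj₁ refl
rim-dominated (suc (suc (suc m))) 1F ()
rim-dominated (suc (suc (suc m))) 2F _ = 1F , refl , inj₂ refl
rim-dominated (suc (suc (suc m))) (suc (suc (suc i))) eq with rim-dominated m i eq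
... | j , two , near = suc (suc (suc j)) , two , map (cong (3 +_)) (cong (3 +_)) near

wheelLabelling : ∀ m → Labelling (suc m)
wheelLabelling m zero    = 2F
wheelLabelling m (suc i) = rim m i

wheelLabelling-dominating : ∀ m (3≤m : 3 ≤ m) →
                            IsRoman2TupleDominating (cone (cycle m 3≤m)) (wheelLabelling m)
wheelLabelling-dominating m 3≤m@(s≤s (s≤s (s≤s _))) = record { at-zero = at-zero ; at-nonzero = at-nonzero }
  where
  W = cone (cycle m 3≤m)
  f = wheelLabelling m

  at-zero : ∀ v → f v ≡ 0F → 2 ≤ length (neighboursLabelled2 W f v)
  at-zero (suc i) eq with rim-dominated m i eq
  -- `s≤s` accounts for the hub, which heads the filtered list; the second neighbour is the rim
  -- vertex `j`.
  ... | j , two , near = s≤s (filter-some (λ w → adj? W (suc i) w ×-dec (f w Fin.≟ 2F))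
                                          (tabulate⁺ {f = suc} j (map inj₁ inj₁ near , two)))

  at-nonzero : ∀ v → f v ≢ 0F → 1 ≤ length (neighboursLabelled2 W f v)
  -- As `m` is at least 3, the hub sees the label 2 in the first block of the rim.
  at-nonzero zero    _ = s≤s z≤n
  at-nonzero (suc i) _ = s≤s z≤n

proposition11 : ∀ (n : ℕ) (n≥4 : 4 ≤ n) → γ×2R[ wheel n n≥4 ]= (⌈ 2 * (n ∸ 1) / 3 ⌉ + 2)
proposition11 (suc m) (s≤s 3≤m) = record
  { attained = wheelLabelling m , wheelLabelling-dominating m 3≤m
             , trans (cong (2 +_) (weight-rim m)) (+-comm 2 ⌈ 2 * m / 3 ⌉)
  ; minimal  = λ f dom → ⌈/⌉+-≤ (2 * m) 2 (weight f) 3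
      (hub-rim-bound m 3≤m (f zero) (weight (f ∘ suc)) (rim-weight-bound m 3≤m f dom))
  }
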